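{- (q-Seidel formula) For every $n\ge 1$, $$\sum_{k=0}^{\lfloor n/2\rfloor}q^{\binom{2k}{2}}\begin{bmatrix} n\\ 2k\end{bmatrix}(-1)^k\frac{(-q^{n-2k+1};q)_{2k}}{(-q^{2n-2k};q)_{2k}}G_{2n-2k}(q)=[n=1].$$
   Context: Let $q$ be a real number with $q\neq -1$. Let $[m]=1+q+\dots+q^{m-1}$, $[m]!=[1]\cdots[m]$, $\begin{bmatrix} m\\ j\end{bmatrix}=\frac{[m]!}{[j]![m-j]!}$, and $(a;q)_m=(1-a)(1-aq)\cdots(1-aq^{m-1})$ (so $(-q^b;q)_m=\prod_{i=0}^{m-1}(1+q^{b+i})$). $[P]$ is $1$ if $P$ holds and $0$ otherwise. The $q$-exponential is $e(z)=\sum_{n\ge0}z^n/[n]!$, and the $q$-Genocchi numbers $G_{2n}(q)$, $n\ge1$, are defined by the formal power series identity $z\frac{e(z)-e(-z)}{e(z)+e(-z)}=\sum_{n\ge1}\frac{(-1)^{n-1}G_{2n}(q)(-q;q)_{2n-1}}{[2n]!}z^{2n}$.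
   Formalization: The formula is proved for rational q ≠ -1, whereas the statement takes q to be any real number with q ≠ -1. -}

module Defs where

open import Data.Nat as ℕ using (ℕ; zero; suc; _∸_)
open import Data.Nat.Combinatorics using (_C_)
open import Data.Bool using (if_then_else_)
open import Data.Rational using (ℚ; 0ℚ; 1ℚ; _+_; _*_; -_; _-_; 1/_; ≢-nonZero)
open import Data.Rational.Properties using (_≟_)
open import Relation.Nullary using (yes; no)

-- Total multiplicative inverse on ℚ (0 ↦ 0); only ever applied to nonzero
-- quantities under the hypothesis q ≠ -1.
inv : ℚ → ℚ
inv x with x ≟ 0ℚ
... | yes _ = 0ℚ
... | no x≢0 = 1/_ x {{≢-nonZero x≢0}}

infixl 7 _÷_
_÷_ : ℚ → ℚ → ℚ
x ÷ y = x * inv y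

infixr 8 _^_
_^_ : ℚ → ℕ → ℚ
x ^ zero = 1ℚ
x ^ suc n = x * (x ^ n)

sumTo : ℕ → (ℕ → ℚ) → ℚ
sumTo zero f = 0ℚ
sumTo (suc n) f = sumTo n f + f n

prodTo : ℕ → (ℕ → ℚ) → ℚ
prodTo zero f = 1ℚ
prodTo (suc n) f = prodTo n f * f n

qint : ℚ → ℕ → ℚ
qint q m = sumTo m (λ i → q ^ i)

qfact : ℚ → ℕ → ℚ
qfact q m = prodTo m (λ i → qint q (suc i))

qbinom : ℚ → ℕ → ℕ → ℚ
qbinom q m j = qfact q m ÷ (qfact q j * qfact q (m ∸ j))

poch : ℚ → ℚ → ℕ → ℚ
poch a q m = prodTo m (λ i → 1ℚ - a * q ^ i)

iverson1 : ℕ → ℚ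
iverson1 n = if n ℕ.≡ᵇ 1 then 1ℚ else 0ℚ

-- Formal power series over ℚ, represented by coefficient sequences.
Series : Set
Series = ℕ → ℚ

-- Quotient N / D of formal power series (D 0 ≠ 0): the unique F with F * D = N,
-- i.e. Σ_{i≤m} F i * D (m-i) = N m for all m.  divList N D m lists F 0 .. F (m-1).
private
  nextCoeff : Series → Series → ℕ → (ℕ → ℚ) → ℚ
  nextCoeff N D m prev = (N m - sumTo m (λ i → prev i * D (m ∸ i))) ÷ D 0

  divUpTo : Series → Series → ℕ → (ℕ → ℚ)
  divUpTo N D zero = λ _ → 0ℚ
  divUpTo N D (suc m) = λ i →
    if i ℕ.≡ᵇ m then nextCoeff N D m (divUpTo N D m) else divUpTo N D m i

seriesDiv : Series → Series → Series
seriesDiv N D m = divUpTo N D (suc m) m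

qexp : ℚ → Series
qexp q n = inv (qfact q n)

qexpNeg : ℚ → Series
qexpNeg q n = (- 1ℚ) ^ n * inv (qfact q n)

numer : ℚ → Series
numer q zero = 0ℚ
numer q (suc m) = qexp q m - qexpNeg q m

denom : ℚ → Series
denom q m = qexp q m + qexpNeg q m

genSeries : ℚ → Series
genSeries q = seriesDiv (numer q) (denom q)

-- q-Genocchi number G_{2n}(q) (meaningful for n ≥ 1), read off from the identity
-- coeff_{z^{2n}} = (-1)^{n-1} G_{2n}(q) (-q;q)_{2n-1} / [2n]!
qGenocchi : ℚ → ℕ → ℚ
qGenocchi q n =
  (- 1ℚ) ^ (n ∸ 1) * genSeries q (2 ℕ.* n) * qfact q (2 ℕ.* n)
    ÷ poch (- q) q (2 ℕ.* n ∸ 1)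

seidelLHS : ℚ → ℕ → ℚ
seidelLHS q n = sumTo (suc (n ℕ./ 2)) λ k →
  q ^ ((2 ℕ.* k) C 2) * qbinom q n (2 ℕ.* k) * (- 1ℚ) ^ k
    * (poch (- (q ^ (n ∸ 2 ℕ.* k ℕ.+ 1))) q (2 ℕ.* k)
       ÷ poch (- (q ^ (2 ℕ.* n ∸ 2 ℕ.* k))) q (2 ℕ.* k))
    * qGenocchi q (n ∸ k)

module Submission where

-- Let Rₙ(x) = ∏_{i<n} (x² - q^{2i}) / [2i+2] and let D be the q-derivative. Since
-- D Rₙ = x Rₙ₋₁, the values (Dᴹ Rₙ)(1) satisfy a Hermite-type recursion, with solution
-- q^C(j,2) [2n-j]! / ([j]! ∏_{i≤n-j} [2i]) for M = 2n - j. Up to a factor independent of k,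
-- the k-th summand of the formula is therefore f_{2n-2k} (D^{2n-2k} Rₙ)(1), where f_i are
-- the coefficients of F(z) = z (e(z) - e(-z)) / (e(z) + e(-z)). Expanding Rₙ in monomials,
-- the even coefficients of F(z) (e(z) + e(-z)) = z (e(z) - e(-z)) say precisely that
-- ∑_l f_{2l} (D^{2l} P)(1) = (D P)(1) for every even polynomial P. So the whole sum is a
-- multiple of (D Rₙ)(1) = Rₙ₋₁(1), which vanishes unless n = 1.

open import Defs
open import Data.Bool using (true; false; if_then_else_)
open import Data.Nat as ℕ using (ℕ; zero; suc; _≥_; _∸_; z≤n; s≤s)
open import Data.Nat.Combinatorics using (_C_; nC1≡n; nCk+nC[k+1]≡[n+1]C[k+1])
open import Data.Nat.DivMod using (m≡m%n+[m/n]*n; m%n<n; m/n*n≤m; m/n≤m)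
import Data.Nat.Properties as ℕ
open import Data.Product using (_×_; _,_; proj₁)
open import Data.Rational using (ℚ; 0ℚ; 1ℚ; ½; _+_; _*_; -_; _-_; _≤_; _<_; ≢-nonZero; nonNegative; nonPositive)
open import Data.Rational.Properties
open import Data.Sum using (_⊎_; inj₁; inj₂)
open import Relation.Binary.Definitions using (tri<; tri≈; tri>)
open import Relation.Binary.PropositionalEquality
  using (_≡_; _≢_; refl; sym; trans; cong; cong₂; subst; module ≡-Reasoning)
open import Relation.Nullary using (yes; no; contradiction)
open import Relation.Nullary.Decidable using (dec⇒maybe; from-yes)
open import Tactic.RingSolver using (solve-∀)
open import Tactic.RingSolver.Core.AlmostCommutativeRing using (AlmostCommutativeRing; fromCommutativeRing)

open ≡-Reasoning

ℚ-ring : AlmostCommutativeRing _ _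
ℚ-ring = fromCommutativeRing +-*-commutativeRing (λ x → dec⇒maybe (0ℚ ≟ x))

-- Finite sums and products

sumTo-cong : ∀ n {f g : ℕ → ℚ} → (∀ i → i ℕ.< n → f i ≡ g i) → sumTo n f ≡ sumTo n g
sumTo-cong zero    f≗g = refl
sumTo-cong (suc n) f≗g =
  cong₂ _+_ (sumTo-cong n (λ i i<n → f≗g i (ℕ.m<n⇒m<1+n i<n))) (f≗g n (ℕ.n<1+n n))

sumTo-zero : ∀ n {f : ℕ → ℚ} → (∀ i → i ℕ.< n → f i ≡ 0ℚ) → sumTo n f ≡ 0ℚ
sumTo-zero zero    f≗0 = refl
sumTo-zero (suc n) f≗0 =
  cong₂ _+_ (sumTo-zero n (λ i i<n → f≗0 i (ℕ.m<n⇒m<1+n i<n))) (f≗0 n (ℕ.n<1+n n))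

sumTo-+ : ∀ n (f g : ℕ → ℚ) → sumTo n (λ i → f i + g i) ≡ sumTo n f + sumTo n g
sumTo-+ zero    f g = refl
sumTo-+ (suc n) f g = trans (cong (_+ (f n + g n)) (sumTo-+ n f g)) (interchange (sumTo n f) (sumTo n g) (f n) (g n))
  where
  interchange : ∀ a b c d → (a + b) + (c + d) ≡ (a + c) + (b + d)
  interchange = solve-∀ ℚ-ring

sumTo-*ˡ : ∀ n c (f : ℕ → ℚ) → sumTo n (λ i → c * f i) ≡ c * sumTo n f
sumTo-*ˡ zero    c f = sym (*-zeroʳ c)
sumTo-*ˡ (suc n) c f = trans (cong (_+ c * f n) (sumTo-*ˡ n c f)) (sym (*-distribˡ-+ c (sumTo n f) (f n)))

sumTo-head : ∀ n (f : ℕ → ℚ) → sumTo (suc n) f ≡ f 0 + sumTo n (λ i → f (suc i))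
sumTo-head zero    f = +-comm 0ℚ (f 0)
sumTo-head (suc n) f = trans (cong (_+ f (suc n)) (sumTo-head n f)) (+-assoc (f 0) (sumTo n (λ i → f (suc i))) (f (suc n)))

sumTo-reverse : ∀ n (f : ℕ → ℚ) → sumTo (suc n) (λ i → f (n ∸ i)) ≡ sumTo (suc n) f
sumTo-reverse zero    f = refl
sumTo-reverse (suc n) f = begin
  sumTo (suc (suc n)) (λ i → f (suc n ∸ i))    ≡⟨ sumTo-head (suc n) (λ i → f (suc n ∸ i)) ⟩
  f (suc n) + sumTo (suc n) (λ i → f (n ∸ i))  ≡⟨ cong (f (suc n) +_) (sumTo-reverse n f) ⟩
  f (suc n) + sumTo (suc n) f                  ≡⟨ +-comm (f (suc n)) (sumTo (suc n) f) ⟩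
  sumTo (suc (suc n)) f                        ∎

sumTo-swap : ∀ m n (f : ℕ → ℕ → ℚ) →
  sumTo m (λ i → sumTo n (f i)) ≡ sumTo n (λ j → sumTo m (λ i → f i j))
sumTo-swap zero    n f = sym (sumTo-zero n (λ _ _ → refl))
sumTo-swap (suc m) n f =
  trans (cong (_+ sumTo n (f m)) (sumTo-swap m n f)) (sym (sumTo-+ n (λ j → sumTo m (λ i → f i j)) (f m)))

sumTo-truncate : ∀ {m n} {f : ℕ → ℚ} → m ℕ.≤ n → (∀ i → m ℕ.≤ i → f i ≡ 0ℚ) →
  sumTo n f ≡ sumTo m f
sumTo-truncate {m} {zero}  z≤n f≗0 = refl
sumTo-truncate {m} {suc n} {f} m≤1+n f≗0 with ℕ.m≤n⇒m<n∨m≡n m≤1+n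
... | inj₂ refl = refl
... | inj₁ m<1+n = begin
  sumTo n f + f n  ≡⟨ cong (sumTo n f +_) (f≗0 n m≤n) ⟩
  sumTo n f + 0ℚ   ≡⟨ +-identityʳ _ ⟩
  sumTo n f        ≡⟨ sumTo-truncate m≤n f≗0 ⟩
  sumTo m f        ∎
  where m≤n = ℕ.≤-pred m<1+n

-- Needed for the convolution of `genSeries` with `denom`, where e(z) + e(-z) has no odd
-- coefficients.
sumTo-even : ∀ m (f : ℕ → ℚ) → (∀ l → l ℕ.< m → f (suc (2 ℕ.* l)) ≡ 0ℚ) →
  sumTo (suc (2 ℕ.* m)) f ≡ sumTo (suc m) (λ l → f (2 ℕ.* l))
sumTo-even zero    f odd≗0 = refl
sumTo-even (suc m) f odd≗0 = begin
  sumTo (suc (2 ℕ.* suc m)) f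
    ≡⟨ cong (λ i → sumTo i f + f (2 ℕ.* suc m)) (ℕ.*-suc 2 m) ⟩
  (sumTo (suc (2 ℕ.* m)) f + f (suc (2 ℕ.* m))) + f (2 ℕ.* suc m)
    ≡⟨ cong (λ x → (sumTo (suc (2 ℕ.* m)) f + x) + f (2 ℕ.* suc m)) (odd≗0 m (ℕ.n<1+n m)) ⟩
  (sumTo (suc (2 ℕ.* m)) f + 0ℚ) + f (2 ℕ.* suc m)
    ≡⟨ cong (_+ f (2 ℕ.* suc m)) (+-identityʳ (sumTo (suc (2 ℕ.* m)) f)) ⟩
  sumTo (suc (2 ℕ.* m)) f + f (2 ℕ.* suc m)
    ≡⟨ cong (_+ f (2 ℕ.* suc m)) (sumTo-even m f (λ l l<m → odd≗0 l (ℕ.m<n⇒m<1+n l<m))) ⟩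
  sumTo (suc (suc m)) (λ l → f (2 ℕ.* l)) ∎

prodTo-+ : ∀ m n (f : ℕ → ℚ) → prodTo (m ℕ.+ n) f ≡ prodTo m f * prodTo n (λ i → f (m ℕ.+ i))
prodTo-+ m zero    f = trans (cong (λ i → prodTo i f) (ℕ.+-identityʳ m)) (sym (*-identityʳ _))
prodTo-+ m (suc n) f = begin
  prodTo (m ℕ.+ suc n) f                                            ≡⟨ cong (λ i → prodTo i f) (ℕ.+-suc m n) ⟩
  prodTo (m ℕ.+ n) f * f (m ℕ.+ n)                                  ≡⟨ cong (_* f (m ℕ.+ n)) (prodTo-+ m n f) ⟩
  prodTo m f * prodTo n (λ i → f (m ℕ.+ i)) * f (m ℕ.+ n)           ≡⟨ *-assoc (prodTo m f) (prodTo n (λ i → f (m ℕ.+ i))) (f (m ℕ.+ n)) ⟩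
  prodTo m f * (prodTo n (λ i → f (m ℕ.+ i)) * f (m ℕ.+ n))         ∎

prodTo-cong : ∀ n {f g : ℕ → ℚ} → (∀ i → f i ≡ g i) → prodTo n f ≡ prodTo n g
prodTo-cong zero    f≗g = refl
prodTo-cong (suc n) f≗g = cong₂ _*_ (prodTo-cong n f≗g) (f≗g n)

-- Inverses, powers and signs

inv-inverseʳ : ∀ {x} → x ≢ 0ℚ → x * inv x ≡ 1ℚ
inv-inverseʳ {x} x≢0 with x ≟ 0ℚ
... | yes x≡0  = contradiction x≡0 x≢0
... | no  x≢0′ = *-inverseʳ x {{≢-nonZero x≢0′}}

*-≢0 : ∀ {x y} → x ≢ 0ℚ → y ≢ 0ℚ → x * y ≢ 0ℚ
*-≢0 {x} {y} x≢0 y≢0 xy≡0 = y≢0 (begin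
  y                ≡⟨ *-identityˡ y ⟨
  1ℚ * y           ≡⟨ cong (_* y) (inv-inverseʳ x≢0) ⟨
  x * inv x * y    ≡⟨ rearrange x (inv x) y ⟩
  inv x * (x * y)  ≡⟨ cong (inv x *_) xy≡0 ⟩
  inv x * 0ℚ       ≡⟨ *-zeroʳ (inv x) ⟩
  0ℚ               ∎)
  where
  rearrange : ∀ a b c → a * b * c ≡ b * (a * c)
  rearrange = solve-∀ ℚ-ring

prodTo-≢0 : ∀ n {f : ℕ → ℚ} → (∀ i → f i ≢ 0ℚ) → prodTo n f ≢ 0ℚ
prodTo-≢0 zero    f≢0 = λ ()
prodTo-≢0 (suc n) f≢0 = *-≢0 (prodTo-≢0 n f≢0) (f≢0 n)

inv-* : ∀ {x y} → x ≢ 0ℚ → y ≢ 0ℚ → inv (x * y) ≡ inv x * inv y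
inv-* {x} {y} x≢0 y≢0 = begin
  inv (x * y)                                ≡⟨ pad (inv (x * y)) ⟩
  inv (x * y) * (1ℚ * 1ℚ)                    ≡⟨ cong₂ (λ a b → inv (x * y) * (a * b)) (inv-inverseʳ x≢0) (inv-inverseʳ y≢0) ⟨
  inv (x * y) * (x * inv x * (y * inv y))    ≡⟨ rearrange (inv (x * y)) x (inv x) y (inv y) ⟩
  x * y * inv (x * y) * (inv x * inv y)      ≡⟨ cong (_* (inv x * inv y)) (inv-inverseʳ (*-≢0 x≢0 y≢0)) ⟩
  1ℚ * (inv x * inv y)                       ≡⟨ *-identityˡ _ ⟩
  inv x * inv y                              ∎
  where
  pad : ∀ a → a ≡ a * (1ℚ * 1ℚ)
  pad = solve-∀ ℚ-ring
  rearrange : ∀ a b b′ c c′ → a * (b * b′ * (c * c′)) ≡ b * c * a * (b′ * c′)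
  rearrange = solve-∀ ℚ-ring

double-injective : ∀ {x y} → x + x ≡ y + y → x ≡ y
double-injective {x} {y} eq = trans (sym (halve x)) (trans (cong (_* ½) eq) (halve y))
  where
  halve : ∀ x → (x + x) * ½ ≡ x
  halve x = begin
    (x + x) * ½    ≡⟨ *-distribʳ-+ ½ x x ⟩
    x * ½ + x * ½  ≡⟨ *-distribˡ-+ x ½ ½ ⟨
    x * 1ℚ         ≡⟨ *-identityʳ x ⟩
    x              ∎

^-+ : ∀ x m n → x ^ (m ℕ.+ n) ≡ x ^ m * x ^ n
^-+ x zero    n = sym (*-identityˡ _)
^-+ x (suc m) n = trans (cong (x *_) (^-+ x m n)) (sym (*-assoc x (x ^ m) (x ^ n)))

-1^even : ∀ n → (- 1ℚ) ^ (2 ℕ.* n) ≡ 1ℚ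
-1^even zero    = refl
-1^even (suc n) = trans (cong ((- 1ℚ) ^_) (ℕ.*-suc 2 n)) (cong (λ x → - 1ℚ * (- 1ℚ * x)) (-1^even n))

-- Coefficients of a quotient of series

<⇒≡ᵇ-false : ∀ {i m} → i ℕ.< m → (i ℕ.≡ᵇ m) ≡ false
<⇒≡ᵇ-false {zero}  (s≤s _)   = refl
<⇒≡ᵇ-false {suc i} (s≤s i<m) = <⇒≡ᵇ-false i<m

≡ᵇ-refl : ∀ m → (m ℕ.≡ᵇ m) ≡ true
≡ᵇ-refl zero    = refl
≡ᵇ-refl (suc m) = ≡ᵇ-refl m

-- Repeats the private recursion step of `seriesDiv` word for word, so that the two agree
-- definitionally and `refl` can relate them.
nextQuotientCoeff : Series → Series → ℕ → (ℕ → ℚ) → ℚ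
nextQuotientCoeff N D m prev = (N m - sumTo m (λ i → prev i * D (m ∸ i))) ÷ D 0

extendQuotient : Series → Series → ℕ → (ℕ → ℚ) → ℕ → ℚ
extendQuotient N D m prev i = if i ℕ.≡ᵇ m then nextQuotientCoeff N D m prev else prev i

-- The recursion defining seriesDiv is private to Defs; here it is the variable G, which
-- the unifier recovers below from the first hypothesis.
module _
  (G : Series → Series → ℕ → ℕ → ℚ)
  (unfold : ∀ N D m → seriesDiv N D (suc m) ≡
    extendQuotient N D (suc m) (extendQuotient N D m (G N D m)) (suc m))
  (diagonal : ∀ N D m → seriesDiv N D m ≡ G N D (suc m) m)
  (extend : ∀ N D m → G N D (suc m) ≡ extendQuotient N D m (G N D m))
  where

  -- Each step of the recursion overwrites a single index, and these indices increase, so an entry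
  -- never changes once it is written.
  partialQuotient-stable : ∀ N D m i → i ℕ.< m → G N D m i ≡ seriesDiv N D i
  partialQuotient-stable N D (suc m) i i<1+m with ℕ.m≤n⇒m<n∨m≡n i<1+m
  ... | inj₂ refl = sym (diagonal N D m)
  ... | inj₁ (s≤s i<m) = begin
    G N D (suc m) i                   ≡⟨ cong (λ g → g i) (extend N D m) ⟩
    extendQuotient N D m (G N D m) i  ≡⟨ cong (λ b → if b then nextQuotientCoeff N D m (G N D m) else G N D m i) (<⇒≡ᵇ-false i<m) ⟩
    G N D m i                         ≡⟨ partialQuotient-stable N D m i i<m ⟩
    seriesDiv N D i                   ∎

  seriesDiv-rec′ : ∀ N D m → seriesDiv N D m ≡ nextQuotientCoeff N D m (seriesDiv N D)
  seriesDiv-rec′ N D m = begin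
    seriesDiv N D m                        ≡⟨ diagonal N D m ⟩
    G N D (suc m) m                        ≡⟨ cong (λ g → g m) (extend N D m) ⟩
    extendQuotient N D m (G N D m) m       ≡⟨ cong (λ b → if b then nextQuotientCoeff N D m (G N D m) else G N D m m) (≡ᵇ-refl m) ⟩
    nextQuotientCoeff N D m (G N D m)      ≡⟨ cong (λ s → (N m - s) ÷ D 0) (sumTo-cong m (λ i i<m →
                                                cong (_* D (m ∸ i)) (partialQuotient-stable N D m i i<m))) ⟩
    nextQuotientCoeff N D m (seriesDiv N D) ∎

seriesDiv-rec : ∀ N D m → seriesDiv N D m ≡ nextQuotientCoeff N D m (seriesDiv N D)
seriesDiv-rec = seriesDiv-rec′ _ (λ _ _ _ → refl) (λ _ _ _ → refl) (λ _ _ _ → refl)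

seriesDiv-* : ∀ N D → D 0 ≢ 0ℚ → ∀ m → sumTo (suc m) (λ i → seriesDiv N D i * D (m ∸ i)) ≡ N m
seriesDiv-* N D D0≢0 m = begin
  S + seriesDiv N D m * D (m ∸ m)     ≡⟨ cong (λ i → S + seriesDiv N D m * D i) (ℕ.n∸n≡0 m) ⟩
  S + seriesDiv N D m * D 0           ≡⟨ cong (λ x → S + x * D 0) (seriesDiv-rec N D m) ⟩
  S + (N m - S) * inv (D 0) * D 0     ≡⟨ rearrange S (N m) (D 0) (inv (D 0)) ⟩
  S + (N m - S) * (D 0 * inv (D 0))   ≡⟨ cong (λ x → S + (N m - S) * x) (inv-inverseʳ D0≢0) ⟩
  S + (N m - S) * 1ℚ                  ≡⟨ cancel S (N m) ⟩
  N m                                 ∎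
  where
  S = sumTo m (λ i → seriesDiv N D i * D (m ∸ i))
  rearrange : ∀ s n d d′ → s + (n - s) * d′ * d ≡ s + (n - s) * (d * d′)
  rearrange = solve-∀ ℚ-ring
  cancel : ∀ s n → s + (n - s) * 1ℚ ≡ n
  cancel = solve-∀ ℚ-ring

-- q-integers

qint-suc : ∀ q m → qint q (suc m) ≡ 1ℚ + q * qint q m
qint-suc q zero    = sym (trans (cong (1ℚ +_) (*-zeroʳ q)) refl)
qint-suc q (suc m) = trans (cong (_+ q * q ^ m) (qint-suc q m)) (regroup q (qint q m) (q ^ m))
  where
  regroup : ∀ q x y → (1ℚ + q * x) + q * y ≡ 1ℚ + q * (x + y)
  regroup = solve-∀ ℚ-ring

qint-+ : ∀ q m n → qint q (m ℕ.+ n) ≡ qint q m + q ^ m * qint q n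
qint-+ q zero    n = unit (qint q n)
  where
  unit : ∀ x → x ≡ 0ℚ + 1ℚ * x
  unit = solve-∀ ℚ-ring
qint-+ q (suc m) n = begin
  qint q (suc (m ℕ.+ n))                      ≡⟨ qint-suc q (m ℕ.+ n) ⟩
  1ℚ + q * qint q (m ℕ.+ n)                   ≡⟨ cong (λ x → 1ℚ + q * x) (qint-+ q m n) ⟩
  1ℚ + q * (qint q m + q ^ m * qint q n)      ≡⟨ regroup q (qint q m) (q ^ m) (qint q n) ⟩
  (1ℚ + q * qint q m) + q * q ^ m * qint q n  ≡⟨ cong (_+ q * q ^ m * qint q n) (qint-suc q m) ⟨
  qint q (suc m) + q ^ suc m * qint q n       ∎
  where
  regroup : ∀ q x y z → 1ℚ + q * (x + y * z) ≡ (1ℚ + q * x) + q * y * z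
  regroup = solve-∀ ℚ-ring

qint-double : ∀ q n → qint q (2 ℕ.* n) ≡ qint q n * (1ℚ + q ^ n)
qint-double q n = begin
  qint q (2 ℕ.* n)               ≡⟨ cong (λ i → qint q (n ℕ.+ i)) (ℕ.+-identityʳ n) ⟩
  qint q (n ℕ.+ n)               ≡⟨ qint-+ q n n ⟩
  qint q n + q ^ n * qint q n    ≡⟨ factor (qint q n) (q ^ n) ⟩
  qint q n * (1ℚ + q ^ n)        ∎
  where
  factor : ∀ x y → x + y * x ≡ x * (1ℚ + y)
  factor = solve-∀ ℚ-ring

-- Nonvanishing of the q-integers

0<1ℚ : 0ℚ < 1ℚ
0<1ℚ = from-yes (0ℚ <? 1ℚ)

qint-positive : ∀ {q} → 0ℚ ≤ q → ∀ m → 0ℚ < qint q (suc m)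
qint-positive 0≤q zero = 0<1ℚ
qint-positive {q} 0≤q (suc m) = subst (0ℚ <_) (sym (qint-suc q (suc m)))
  (+-mono-<-≤ 0<1ℚ (subst (_≤ q * qint q (suc m)) (*-zeroʳ q)
    (*-monoˡ-≤-nonNeg q {{nonNegative 0≤q}} (<⇒≤ (qint-positive 0≤q m)))))

-- The upper bound carries the induction: with x at most 1, qx is at least q, hence above -1, and 1
-- + qx stays positive.
qint-bounds : ∀ {q} → - 1ℚ < q → q ≤ 0ℚ → ∀ m → 0ℚ < qint q (suc m) × qint q (suc m) ≤ 1ℚ
qint-bounds -1<q q≤0 zero = 0<1ℚ , ≤-refl
qint-bounds {q} -1<q q≤0 (suc m) with qint-bounds -1<q q≤0 m
... | 0<x , x≤1 =
  subst (0ℚ <_) (sym (qint-suc q (suc m)))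
    (+-monoʳ-< 1ℚ (<-≤-trans -1<q (subst (_≤ q * qint q (suc m)) (*-identityʳ q) (antitone x≤1)))) ,
  subst (_≤ 1ℚ) (sym (qint-suc q (suc m)))
    (+-monoʳ-≤ 1ℚ (subst (q * qint q (suc m) ≤_) (*-zeroʳ q) (antitone (<⇒≤ 0<x))))
  where
  antitone : ∀ {x y} → x ≤ y → q * y ≤ q * x
  antitone = *-monoˡ-≤-nonPos q {{nonPositive q≤0}}

-- The map x ↦ 1 + qx exchanges the two regions. Mere positivity would not be preserved in this way:
-- it takes x ≥ 1 to force qx below -1.
qint-alternates : ∀ {q} → q < - 1ℚ → ∀ m → 1ℚ ≤ qint q (suc m) ⊎ qint q (suc m) < 0ℚ
qint-alternates {q} q<-1 = alternate
  where
  antitone : ∀ {x y} → x ≤ y → q * y ≤ q * x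
  antitone = *-monoˡ-≤-nonPos q {{nonPositive (<⇒≤ (<-trans q<-1 (from-yes (- 1ℚ <? 0ℚ))))}}

  alternate : ∀ m → 1ℚ ≤ qint q (suc m) ⊎ qint q (suc m) < 0ℚ
  alternate zero = inj₁ ≤-refl
  alternate (suc m) with alternate m
  ... | inj₁ 1≤x = inj₂ (subst (_< 0ℚ) (sym (qint-suc q (suc m)))
      (+-monoʳ-< 1ℚ (≤-<-trans (subst (q * qint q (suc m) ≤_) (*-identityʳ q) (antitone 1≤x)) q<-1)))
  ... | inj₂ x<0 = inj₁ (subst (1ℚ ≤_) (sym (qint-suc q (suc m)))
      (+-monoʳ-≤ 1ℚ (subst (_≤ q * qint q (suc m)) (*-zeroʳ q) (antitone (<⇒≤ x<0)))))

-- The recursion [m+1] = 1 + q[m] is followed separately for q < -1, for -1 < q ≤ 0 and for q ≥ 0.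
-- Every q-dependent denominator below is nonzero because of this lemma.
qint≢0 : ∀ {q} → q ≢ - 1ℚ → ∀ m → qint q (suc m) ≢ 0ℚ
qint≢0 {q} q≢-1 m eq with <-cmp q (- 1ℚ)
... | tri≈ _ q≡-1 _ = q≢-1 q≡-1
... | tri< q<-1 _ _ with qint-alternates q<-1 m
...   | inj₁ 1≤x = <⇒≢ (<-≤-trans 0<1ℚ 1≤x) (sym eq)
...   | inj₂ x<0 = <⇒≢ x<0 eq
qint≢0 {q} q≢-1 m eq | tri> _ _ -1<q with ≤-total 0ℚ q
...   | inj₁ 0≤q = <⇒≢ (qint-positive 0≤q m) (sym eq)
...   | inj₂ q≤0 = <⇒≢ (proj₁ (qint-bounds -1<q q≤0 m)) (sym eq)

-- Falling q-factorials

-- This is [m][m-1]...[m-M+1], the value at 1 of the `M`-th q-derivative of x^m.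
falling : ℚ → ℕ → ℕ → ℚ
falling q m       zero    = 1ℚ
falling q zero    (suc M) = 0ℚ
falling q (suc m) (suc M) = qint q (suc m) * falling q m M

-- The q-Leibniz rule D^M (x f) = q^M x D^M f + [M] D^(M-1) f for f = x^m, evaluated at 1. The
-- truncated `ℕ.pred` is harmless, since its coefficient [0] is zero.
falling-pascal : ∀ q m M →
  falling q (suc m) M ≡ q ^ M * falling q m M + qint q M * falling q m (ℕ.pred M)
falling-pascal q m       zero          = refl
falling-pascal q zero    (suc zero)    = sym (trans (cong (_+ 1ℚ) (*-zeroʳ (q ^ 1))) refl)
falling-pascal q zero    (suc (suc M)) =
  sym (cong₂ _+_ (*-zeroʳ (q ^ suc (suc M))) (*-zeroʳ (qint q (suc (suc M)))))
falling-pascal q (suc m) (suc zero)    =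
  trans (cong (_* 1ℚ) (qint-suc q (suc m))) (regroup q (qint q (suc m)))
  where
  regroup : ∀ q x → (1ℚ + q * x) * 1ℚ ≡ q * 1ℚ * (x * 1ℚ) + 1ℚ * 1ℚ
  regroup = solve-∀ ℚ-ring
falling-pascal q (suc m) (suc (suc M)) = begin
  qint q (suc (suc m)) * (x * f)              ≡⟨ cong (_* (x * f)) (qint-suc q (suc m)) ⟩
  (1ℚ + q * x) * (x * f)                      ≡⟨ expand q x f ⟩
  q * x * (x * f) + x * f                     ≡⟨ cong (λ y → q * x * y + x * f) (falling-pascal q m (suc M)) ⟩
  q * x * (p * g + y * f) + x * f             ≡⟨ regroup q x f g p y ⟩
  q * p * (x * g) + (1ℚ + q * y) * (x * f)    ≡⟨ cong (λ y → q * p * (x * g) + y * (x * f)) (qint-suc q (suc M)) ⟨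
  q * p * (x * g) + qint q (suc (suc M)) * (x * f) ∎
  where
  x = qint q (suc m)
  y = qint q (suc M)
  p = q ^ suc M
  f = falling q m M
  g = falling q m (suc M)
  expand : ∀ q x f → (1ℚ + q * x) * (x * f) ≡ q * x * (x * f) + x * f
  expand = solve-∀ ℚ-ring
  regroup : ∀ q x f g p y →
    q * x * (p * g + y * f) + x * f ≡ q * p * (x * g) + (1ℚ + q * y) * (x * f)
  regroup = solve-∀ ℚ-ring

falling-qfact : ∀ q M r → falling q (M ℕ.+ r) M * qfact q r ≡ qfact q (M ℕ.+ r)
falling-qfact q zero    r = *-identityˡ (qfact q r)
falling-qfact q (suc M) r = begin
  qint q (suc (M ℕ.+ r)) * falling q (M ℕ.+ r) M * qfact q r
    ≡⟨ rearrange (qint q (suc (M ℕ.+ r))) (falling q (M ℕ.+ r) M) (qfact q r) ⟩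
  falling q (M ℕ.+ r) M * qfact q r * qint q (suc (M ℕ.+ r))
    ≡⟨ cong (_* qint q (suc (M ℕ.+ r))) (falling-qfact q M r) ⟩
  qfact q (suc M ℕ.+ r) ∎
  where
  rearrange : ∀ a b c → a * b * c ≡ b * c * a
  rearrange = solve-∀ ℚ-ring

falling-zero : ∀ q {m M} → m ℕ.< M → falling q m M ≡ 0ℚ
falling-zero q {zero}  (s≤s _)   = refl
falling-zero q {suc m} (s≤s m<M) =
  trans (cong (qint q (suc m) *_) (falling-zero q m<M)) (*-zeroʳ (qint q (suc m)))

-- Allows the defining equation to be used at an index that is a successor only up to a proof.
falling-suc : ∀ q {x y} M → x ≡ suc y → falling q x (suc M) ≡ qint q x * falling q y M
falling-suc q M refl = refl

-- The q-derivatives at 1 of the polynomials ∏_{i<n} (x² - q^{2i}) / [2i+2]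

evenFact : ℚ → ℕ → ℚ
evenFact q n = prodTo n (λ i → qint q (2 ℕ.* suc i))

weight : ℚ → ℕ → ℕ → ℚ
weight q n k = prodTo k (λ i → - (q ^ (2 ℕ.* i))) * inv (evenFact q k) * inv (evenFact q (n ∸ k))

-- The coefficient of x^{2(n-k)} in the polynomial is weight q n k, by the q²-binomial theorem.
deriv : ℚ → ℕ → ℕ → ℚ
deriv q M n = sumTo (suc n) (λ k → weight q n k * falling q (2 ℕ.* (n ∸ k)) M)

^-triangular : ∀ q j → q ^ (suc j C 2) ≡ q ^ j * q ^ (j C 2)
^-triangular q j = begin
  q ^ (suc j C 2)        ≡⟨ cong (q ^_) (nCk+nC[k+1]≡[n+1]C[k+1] j 1) ⟨
  q ^ (j C 1 ℕ.+ j C 2)  ≡⟨ cong (λ i → q ^ (i ℕ.+ j C 2)) (nC1≡n j) ⟩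
  q ^ (j ℕ.+ j C 2)      ≡⟨ ^-+ q j (j C 2) ⟩
  q ^ j * q ^ (j C 2)    ∎

module _ {q : ℚ} (q≢-1 : q ≢ - 1ℚ) where

  qfact≢0 : ∀ n → qfact q n ≢ 0ℚ
  qfact≢0 n = prodTo-≢0 n (qint≢0 q≢-1)

  qint-even≢0 : ∀ n → qint q (2 ℕ.* suc n) ≢ 0ℚ
  qint-even≢0 n = qint≢0 q≢-1 (n ℕ.+ (suc n ℕ.+ 0))

  evenFact≢0 : ∀ n → evenFact q n ≢ 0ℚ
  evenFact≢0 n = prodTo-≢0 n qint-even≢0

  inv-evenFact : ∀ n → inv (evenFact q n) ≡ inv (evenFact q (suc n)) * qint q (2 ℕ.* suc n)
  inv-evenFact n = sym (begin
    inv (e * x) * x          ≡⟨ cong (_* x) (inv-* (evenFact≢0 n) (qint-even≢0 n)) ⟩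
    inv e * inv x * x        ≡⟨ rearrange (inv e) (inv x) x ⟩
    inv e * (x * inv x)      ≡⟨ cong (inv e *_) (inv-inverseʳ (qint-even≢0 n)) ⟩
    inv e * 1ℚ               ≡⟨ *-identityʳ (inv e) ⟩
    inv e                    ∎)
    where
    e = evenFact q n
    x = qint q (2 ℕ.* suc n)
    rearrange : ∀ a b c → a * b * c ≡ a * (c * b)
    rearrange = solve-∀ ℚ-ring

  -- Coefficientwise this is D R_{n+1} = x R_n: the factor brought down from x^(2(n+1-k)) cancels
  -- the last factor of `evenFact q (suc n ∸ k)`.
  weight-suc : ∀ n {k} → k ℕ.≤ n →
    weight q (suc n) k * qint q (2 ℕ.* (suc n ∸ k)) ≡ weight q n k
  weight-suc n {k} k≤n = begin
    σ * inv (evenFact q (suc n ∸ k)) * qint q (2 ℕ.* (suc n ∸ k))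
      ≡⟨ cong (λ i → σ * inv (evenFact q i) * qint q (2 ℕ.* i)) (ℕ.+-∸-assoc 1 k≤n) ⟩
    σ * inv (evenFact q (suc (n ∸ k))) * qint q (2 ℕ.* suc (n ∸ k))
      ≡⟨ *-assoc σ (inv (evenFact q (suc (n ∸ k)))) (qint q (2 ℕ.* suc (n ∸ k))) ⟩
    σ * (inv (evenFact q (suc (n ∸ k))) * qint q (2 ℕ.* suc (n ∸ k)))
      ≡⟨ cong (σ *_) (inv-evenFact (n ∸ k)) ⟨
    weight q n k ∎
    where σ = prodTo k (λ i → - (q ^ (2 ℕ.* i))) * inv (evenFact q k)

  -- The companion of `weight-suc` in the other index, which makes the shifted terms in
  -- `deriv-zero-suc` match.
  weight-suc-suc : ∀ n k →
    weight q (suc n) (suc k) * qint q (2 ℕ.* suc k) ≡ - (q ^ (2 ℕ.* k)) * weight q n k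
  weight-suc-suc n k = begin
    σ * p * inv (evenFact q (suc k)) * e * x      ≡⟨ rearrange σ p (inv (evenFact q (suc k))) e x ⟩
    p * (σ * (inv (evenFact q (suc k)) * x) * e)  ≡⟨ cong (λ y → p * (σ * y * e)) (inv-evenFact k) ⟨
    p * weight q n k                              ∎
    where
    σ = prodTo k (λ i → - (q ^ (2 ℕ.* i)))
    p = - (q ^ (2 ℕ.* k))
    e = inv (evenFact q (n ∸ k))
    x = qint q (2 ℕ.* suc k)
    rearrange : ∀ σ p a e x → σ * p * a * e * x ≡ p * (σ * (a * x) * e)
    rearrange = solve-∀ ℚ-ring

  -- D ∏_{i≤n} (x² - q^{2i}) = [2n+2] x ∏_{i<n} (x² - q^{2i}), followed by the q-Leibniz rule.
  deriv-suc : ∀ M n →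
    deriv q (suc M) (suc n) ≡ q ^ M * deriv q M n + qint q M * deriv q (ℕ.pred M) n
  deriv-suc M n = begin
    sumTo (suc n) t + t (suc n)
      ≡⟨ cong₂ _+_ (sumTo-cong (suc n) (λ k k<1+n → step k (ℕ.≤-pred k<1+n))) last ⟩
    sumTo (suc n) (λ k → q ^ M * u k + qint q M * v k) + 0ℚ
      ≡⟨ +-identityʳ (sumTo (suc n) (λ k → q ^ M * u k + qint q M * v k)) ⟩
    sumTo (suc n) (λ k → q ^ M * u k + qint q M * v k)
      ≡⟨ sumTo-+ (suc n) (λ k → q ^ M * u k) (λ k → qint q M * v k) ⟩
    sumTo (suc n) (λ k → q ^ M * u k) + sumTo (suc n) (λ k → qint q M * v k)
      ≡⟨ cong₂ _+_ (sumTo-*ˡ (suc n) (q ^ M) u) (sumTo-*ˡ (suc n) (qint q M) v) ⟩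
    q ^ M * deriv q M n + qint q M * deriv q (ℕ.pred M) n ∎
    where
    t u v : ℕ → ℚ
    t k = weight q (suc n) k * falling q (2 ℕ.* (suc n ∸ k)) (suc M)
    u k = weight q n k * falling q (2 ℕ.* (n ∸ k)) M
    v k = weight q n k * falling q (2 ℕ.* (n ∸ k)) (ℕ.pred M)

    -- The constant term of the polynomial is killed by the derivative.
    last : t (suc n) ≡ 0ℚ
    last = trans (cong (λ i → weight q (suc n) (suc n) * falling q (2 ℕ.* i) (suc M)) (ℕ.n∸n≡0 n))
                 (*-zeroʳ (weight q (suc n) (suc n)))

    distribute : ∀ w a b c d → w * (a * b + c * d) ≡ a * (w * b) + c * (w * d)
    distribute = solve-∀ ℚ-ring

    step : ∀ k → k ℕ.≤ n → t k ≡ q ^ M * u k + qint q M * v k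
    step k k≤n = begin
      w * falling q (2 ℕ.* (suc n ∸ k)) (suc M)
        ≡⟨ cong (w *_) (falling-suc q M (trans (cong (2 ℕ.*_) (ℕ.+-∸-assoc 1 k≤n)) (ℕ.*-suc 2 m))) ⟩
      w * (x * falling q (suc (2 ℕ.* m)) M)
        ≡⟨ *-assoc w x (falling q (suc (2 ℕ.* m)) M) ⟨
      w * x * falling q (suc (2 ℕ.* m)) M
        ≡⟨ cong₂ _*_ (weight-suc n k≤n) (falling-pascal q (2 ℕ.* m) M) ⟩
      weight q n k * (q ^ M * falling q (2 ℕ.* m) M + qint q M * falling q (2 ℕ.* m) (ℕ.pred M))
        ≡⟨ distribute (weight q n k) (q ^ M) (falling q (2 ℕ.* m) M) (qint q M) (falling q (2 ℕ.* m) (ℕ.pred M)) ⟩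
      q ^ M * u k + qint q M * v k ∎
      where
      m = n ∸ k
      w = weight q (suc n) k
      x = qint q (2 ℕ.* (suc n ∸ k))

  -- Splitting [2n+2] = [2k] + q^{2k} [2(n+1-k)] makes the sum telescope.
  deriv-zero-suc : ∀ n → deriv q 0 (suc n) ≡ 0ℚ
  deriv-zero-suc n = begin
    deriv q 0 (suc n)            ≡⟨ *-identityˡ (deriv q 0 (suc n)) ⟨
    1ℚ * deriv q 0 (suc n)       ≡⟨ cong (_* deriv q 0 (suc n)) (inv-inverseʳ (qint-even≢0 n)) ⟨
    z * inv z * deriv q 0 (suc n) ≡⟨ rearrange z (inv z) (deriv q 0 (suc n)) ⟩
    inv z * (z * deriv q 0 (suc n)) ≡⟨ cong (inv z *_) vanish ⟩
    inv z * 0ℚ                   ≡⟨ *-zeroʳ (inv z) ⟩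
    0ℚ                           ∎
    where
    z = qint q (2 ℕ.* suc n)
    -- `a` and `b` are the two parts of the split. `b` reduces to `c`, and `a` shifted by one index
    -- reduces to its negative.
    a b c : ℕ → ℚ
    a k = weight q (suc n) k * qint q (2 ℕ.* k)
    b k = q ^ (2 ℕ.* k) * (weight q (suc n) k * qint q (2 ℕ.* (suc n ∸ k)))
    c k = q ^ (2 ℕ.* k) * weight q n k

    rearrange : ∀ a b c → a * b * c ≡ b * (a * c)
    rearrange = solve-∀ ℚ-ring

    neg-cancel : ∀ p w → - p * w + p * w ≡ 0ℚ
    neg-cancel = solve-∀ ℚ-ring

    distribute : ∀ w x p y → (x + p * y) * (w * 1ℚ) ≡ w * x + p * (w * y)
    distribute = solve-∀ ℚ-ring

    split : ∀ k → k ℕ.≤ suc n → z * (weight q (suc n) k * 1ℚ) ≡ a k + b k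
    split k k≤1+n = begin
      z * (weight q (suc n) k * 1ℚ)
        ≡⟨ cong (λ i → qint q (2 ℕ.* i) * (weight q (suc n) k * 1ℚ)) (ℕ.m+[n∸m]≡n k≤1+n) ⟨
      qint q (2 ℕ.* (k ℕ.+ (suc n ∸ k))) * (weight q (suc n) k * 1ℚ)
        ≡⟨ cong (λ i → qint q i * (weight q (suc n) k * 1ℚ)) (ℕ.*-distribˡ-+ 2 k (suc n ∸ k)) ⟩
      qint q (2 ℕ.* k ℕ.+ 2 ℕ.* (suc n ∸ k)) * (weight q (suc n) k * 1ℚ)
        ≡⟨ cong (_* (weight q (suc n) k * 1ℚ)) (qint-+ q (2 ℕ.* k) (2 ℕ.* (suc n ∸ k))) ⟩
      (qint q (2 ℕ.* k) + q ^ (2 ℕ.* k) * qint q (2 ℕ.* (suc n ∸ k))) * (weight q (suc n) k * 1ℚ)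
        ≡⟨ distribute (weight q (suc n) k) (qint q (2 ℕ.* k)) (q ^ (2 ℕ.* k)) (qint q (2 ℕ.* (suc n ∸ k))) ⟩
      a k + b k ∎

    lower : sumTo (suc (suc n)) a ≡ sumTo (suc n) (λ k → - (q ^ (2 ℕ.* k)) * weight q n k)
    lower = begin
      sumTo (suc (suc n)) a                     ≡⟨ sumTo-head (suc n) a ⟩
      a 0 + sumTo (suc n) (λ k → a (suc k))     ≡⟨ cong (_+ sumTo (suc n) (λ k → a (suc k))) (*-zeroʳ (weight q (suc n) 0)) ⟩
      0ℚ + sumTo (suc n) (λ k → a (suc k))      ≡⟨ +-identityˡ (sumTo (suc n) (λ k → a (suc k))) ⟩
      sumTo (suc n) (λ k → a (suc k))           ≡⟨ sumTo-cong (suc n) (λ k _ → weight-suc-suc n k) ⟩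
      sumTo (suc n) (λ k → - (q ^ (2 ℕ.* k)) * weight q n k) ∎

    b-last : b (suc n) ≡ 0ℚ
    b-last = begin
      b (suc n)
        ≡⟨ cong (λ i → q ^ (2 ℕ.* suc n) * (weight q (suc n) (suc n) * qint q (2 ℕ.* i))) (ℕ.n∸n≡0 n) ⟩
      q ^ (2 ℕ.* suc n) * (weight q (suc n) (suc n) * 0ℚ)
        ≡⟨ cong (q ^ (2 ℕ.* suc n) *_) (*-zeroʳ (weight q (suc n) (suc n))) ⟩
      q ^ (2 ℕ.* suc n) * 0ℚ
        ≡⟨ *-zeroʳ (q ^ (2 ℕ.* suc n)) ⟩
      0ℚ ∎

    upper : sumTo (suc (suc n)) b ≡ sumTo (suc n) c
    upper = begin
      sumTo (suc n) b + b (suc n)  ≡⟨ cong (sumTo (suc n) b +_) b-last ⟩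
      sumTo (suc n) b + 0ℚ         ≡⟨ +-identityʳ (sumTo (suc n) b) ⟩
      sumTo (suc n) b              ≡⟨ sumTo-cong (suc n) (λ k k<1+n →
                                        cong (q ^ (2 ℕ.* k) *_) (weight-suc n (ℕ.≤-pred k<1+n))) ⟩
      sumTo (suc n) c              ∎

    vanish : z * deriv q 0 (suc n) ≡ 0ℚ
    vanish = begin
      z * deriv q 0 (suc n)
        ≡⟨ sumTo-*ˡ (suc (suc n)) z (λ k → weight q (suc n) k * 1ℚ) ⟨
      sumTo (suc (suc n)) (λ k → z * (weight q (suc n) k * 1ℚ))
        ≡⟨ sumTo-cong (suc (suc n)) (λ k k<2+n → split k (ℕ.≤-pred k<2+n)) ⟩
      sumTo (suc (suc n)) (λ k → a k + b k)
        ≡⟨ sumTo-+ (suc (suc n)) a b ⟩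
      sumTo (suc (suc n)) a + sumTo (suc (suc n)) b
        ≡⟨ cong₂ _+_ lower upper ⟩
      sumTo (suc n) (λ k → - (q ^ (2 ℕ.* k)) * weight q n k) + sumTo (suc n) c
        ≡⟨ sumTo-+ (suc n) (λ k → - (q ^ (2 ℕ.* k)) * weight q n k) c ⟨
      sumTo (suc n) (λ k → - (q ^ (2 ℕ.* k)) * weight q n k + c k)
        ≡⟨ sumTo-zero (suc n) (λ k _ → neg-cancel (q ^ (2 ℕ.* k)) (weight q n k)) ⟩
      0ℚ ∎

  -- Vanishing and closed form of the q-derivatives at 1

  combination-zero : ∀ x y {a b} → a ≡ 0ℚ → b ≡ 0ℚ → x * a + y * b ≡ 0ℚ
  combination-zero x y refl refl = cong₂ _+_ (*-zeroʳ x) (*-zeroʳ y)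

  -- R_n vanishes at 1, q, ..., q^(n-1), and for q other than 0 and 1 the value (D^M R_n)(1) is a
  -- combination of those at 1, ..., q^M. The induction along `deriv-suc` avoids this case
  -- distinction.
  deriv-below : ∀ {M n} → M ℕ.< n → deriv q M n ≡ 0ℚ
  deriv-below {zero}  {suc n} _         = deriv-zero-suc n
  deriv-below {suc M} {suc n} (s≤s M<n) = trans (deriv-suc M n)
    (combination-zero (q ^ M) (qint q M) (deriv-below M<n)
      (deriv-below (ℕ.≤-<-trans ℕ.pred[n]≤n M<n)))

  -- R_n has degree 2n.
  deriv-above : ∀ M n → 2 ℕ.* n ℕ.< M → deriv q M n ≡ 0ℚ
  deriv-above (suc M) zero    _   = trans (cong (0ℚ +_) (*-zeroʳ (weight q 0 0))) refl
  deriv-above (suc M) (suc n) lt with subst (ℕ._< suc M) (ℕ.*-suc 2 n) lt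
  ... | s≤s (s≤s {n = M′} 2n<M′) = trans (deriv-suc M n)
    (combination-zero (q ^ M) (qint q M) (deriv-above M n (ℕ.m<n⇒m<1+n 2n<M′))
      (deriv-above M′ n 2n<M′))

  -- The order is 2n - j with `s` = n - j. In `deriv-suc` the first term lowers `j` and the second
  -- lowers `s`, so the induction runs over a grid. On the edge `s` = 0 the second term vanishes by
  -- `deriv-below` or because [0] = 0, and on the edge `j` = 0 the first vanishes by `deriv-above`.
  -- Keeping `n` separate lets both smaller cases refer to the same `n`.
  deriv-closed : ∀ s j n → n ≡ s ℕ.+ j →
    qfact q j * deriv q (s ℕ.+ n) n ≡ q ^ (j C 2) * (inv (evenFact q s) * qfact q (s ℕ.+ n))
  deriv-closed zero zero n refl = refl
  deriv-closed zero (suc j) n refl = begin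
    f * x * deriv q (suc j) (suc j)     ≡⟨ cong (f * x *_) (trans (deriv-suc j j) (cong (q ^ j * deriv q j j +_) (second j))) ⟩
    f * x * (q ^ j * deriv q j j + 0ℚ)  ≡⟨ rearrange f x (q ^ j) (deriv q j j) ⟩
    q ^ j * (f * deriv q j j) * x       ≡⟨ cong (λ y → q ^ j * y * x) (deriv-closed zero j j refl) ⟩
    q ^ j * (q ^ (j C 2) * (e * f)) * x ≡⟨ regroup (q ^ j) (q ^ (j C 2)) e f x ⟩
    q ^ j * q ^ (j C 2) * (e * (f * x)) ≡⟨ cong (_* (e * (f * x))) (^-triangular q j) ⟨
    q ^ (suc j C 2) * (e * (f * x))     ∎
    where
    f = qfact q j
    x = qint q (suc j)
    e = inv (evenFact q 0)
    second : ∀ j → qint q j * deriv q (ℕ.pred j) j ≡ 0ℚ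
    second zero    = refl
    second (suc j) = trans (cong (qint q (suc j) *_) (deriv-below (ℕ.n<1+n j))) (*-zeroʳ (qint q (suc j)))
    rearrange : ∀ f x p d → f * x * (p * d + 0ℚ) ≡ p * (f * d) * x
    rearrange = solve-∀ ℚ-ring
    regroup : ∀ p c e f x → p * (c * (e * f)) * x ≡ p * c * (e * (f * x))
    regroup = solve-∀ ℚ-ring
  deriv-closed (suc s) zero (suc n) eq rewrite ℕ.+-suc s n = begin
    1ℚ * deriv q (suc (suc (s ℕ.+ n))) (suc n)
      ≡⟨ cong (1ℚ *_) (deriv-suc (suc (s ℕ.+ n)) n) ⟩
    1ℚ * (p * deriv q (suc (s ℕ.+ n)) n + x * deriv q (s ℕ.+ n) n)
      -- Here n = s, so the order s + n + 1 exceeds the degree 2n by one.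
      ≡⟨ cong (λ y → 1ℚ * (p * y + x * deriv q (s ℕ.+ n) n)) (deriv-above (suc (s ℕ.+ n)) n 2n<1+s+n) ⟩
    1ℚ * (p * 0ℚ + x * deriv q (s ℕ.+ n) n)
      ≡⟨ rearrange p x (deriv q (s ℕ.+ n) n) ⟩
    x * (1ℚ * deriv q (s ℕ.+ n) n)
      ≡⟨ cong (x *_) (deriv-closed s zero n n≡s+0) ⟩
    x * (1ℚ * (inv (evenFact q s) * f))
      ≡⟨ cong (λ y → x * (1ℚ * (y * f))) (trans (inv-evenFact s) (cong (λ i → e * qint q i) 2+2s)) ⟩
    x * (1ℚ * (e * y * f))
      ≡⟨ regroup x e y f ⟩
    1ℚ * (e * (f * x * y)) ∎
    where
    n≡s+0 : n ≡ s ℕ.+ 0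
    n≡s+0 = ℕ.suc-injective eq
    n≡s = trans n≡s+0 (ℕ.+-identityʳ s)
    2n<1+s+n : 2 ℕ.* n ℕ.< suc (s ℕ.+ n)
    2n<1+s+n = s≤s (ℕ.≤-reflexive (cong₂ ℕ._+_ n≡s (ℕ.+-identityʳ n)))
    2+2s : 2 ℕ.* suc s ≡ suc (suc (s ℕ.+ n))
    2+2s = trans (ℕ.*-suc 2 s) (cong (λ i → suc (suc (s ℕ.+ i))) (sym n≡s+0))
    p = q ^ suc (s ℕ.+ n)
    x = qint q (suc (s ℕ.+ n))
    y = qint q (suc (suc (s ℕ.+ n)))
    f = qfact q (s ℕ.+ n)
    e = inv (evenFact q (suc s))
    rearrange : ∀ p x d → 1ℚ * (p * 0ℚ + x * d) ≡ x * (1ℚ * d)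
    rearrange = solve-∀ ℚ-ring
    regroup : ∀ x e y f → x * (1ℚ * (e * y * f)) ≡ 1ℚ * (e * (f * x * y))
    regroup = solve-∀ ℚ-ring
  deriv-closed (suc s) (suc j) (suc n) eq rewrite ℕ.+-suc s n = begin
    a * J * deriv q (suc (suc (s ℕ.+ n))) (suc n)
      ≡⟨ cong (a * J *_) (deriv-suc (suc (s ℕ.+ n)) n) ⟩
    a * J * (q ^ suc (s ℕ.+ n) * d₁ + X * d₂)
      ≡⟨ cong (λ y → a * J * (y * d₁ + X * d₂)) power ⟩
    a * J * (p * W * d₁ + X * d₂)
      ≡⟨ rearrange a J p W d₁ X d₂ ⟩
    p * W * J * (a * d₁) + X * (a * J * d₂)
      ≡⟨ cong₂ (λ y z → p * W * J * y + X * z)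
           (deriv-closed (suc s) j n (trans n≡s+1+j (ℕ.+-suc s j)))
           (deriv-closed s (suc j) n n≡s+1+j) ⟩
    p * W * J * (c * (e * (f * X))) + X * (q ^ (suc j C 2) * (inv (evenFact q s) * f))
      ≡⟨ cong₂ (λ y z → p * W * J * (c * (e * (f * X))) + X * (y * (z * f))) (^-triangular q j) (inv-evenFact s) ⟩
    p * W * J * (c * (e * (f * X))) + X * (p * c * (e * T * f))
      ≡⟨ regroup p W J c e f X T ⟩
    p * c * (e * (f * X * (T + W * J)))
      -- The two contributions recombine through [2s+2] + q^(2s+2) [j+1] = [2s+j+3].
      ≡⟨ cong₂ (λ y z → y * (e * (f * X * z))) (^-triangular q j) sum-qint ⟨
    q ^ (suc j C 2) * (e * (f * X * qint q (suc (suc (s ℕ.+ n))))) ∎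
    where
    n≡s+1+j : n ≡ s ℕ.+ suc j
    n≡s+1+j = ℕ.suc-injective eq
    a = qfact q j
    J = qint q (suc j)
    p = q ^ j
    W = q ^ (2 ℕ.* suc s)
    T = qint q (2 ℕ.* suc s)
    X = qint q (suc (s ℕ.+ n))
    c = q ^ (j C 2)
    e = inv (evenFact q (suc s))
    f = qfact q (s ℕ.+ n)
    d₁ = deriv q (suc (s ℕ.+ n)) n
    d₂ = deriv q (s ℕ.+ n) n
    index : suc (suc (s ℕ.+ n)) ≡ 2 ℕ.* suc s ℕ.+ suc j
    index = begin
      suc (suc (s ℕ.+ n))             ≡⟨ cong (λ i → suc (suc (s ℕ.+ i))) n≡s+1+j ⟩
      suc (suc (s ℕ.+ (s ℕ.+ suc j))) ≡⟨ cong (λ i → suc (suc i)) (ℕ.+-assoc s s (suc j)) ⟨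
      suc (suc (s ℕ.+ s ℕ.+ suc j))   ≡⟨ cong (λ i → suc (suc (s ℕ.+ i ℕ.+ suc j))) (ℕ.+-identityʳ s) ⟨
      2 ℕ.+ 2 ℕ.* s ℕ.+ suc j         ≡⟨ cong (ℕ._+ suc j) (ℕ.*-suc 2 s) ⟨
      2 ℕ.* suc s ℕ.+ suc j           ∎
    power : q ^ suc (s ℕ.+ n) ≡ p * W
    power = begin
      q ^ suc (s ℕ.+ n)      ≡⟨ cong (q ^_) (ℕ.suc-injective (trans index (ℕ.+-suc (2 ℕ.* suc s) j))) ⟩
      q ^ (2 ℕ.* suc s ℕ.+ j) ≡⟨ ^-+ q (2 ℕ.* suc s) j ⟩
      W * p                  ≡⟨ *-comm W p ⟩
      p * W                  ∎
    sum-qint : qint q (suc (suc (s ℕ.+ n))) ≡ T + W * J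
    sum-qint = trans (cong (qint q) index) (qint-+ q (2 ℕ.* suc s) (suc j))
    rearrange : ∀ a J p W d₁ X d₂ →
      a * J * (p * W * d₁ + X * d₂) ≡ p * W * J * (a * d₁) + X * (a * J * d₂)
    rearrange = solve-∀ ℚ-ring
    regroup : ∀ p W J c e f X T →
      p * W * J * (c * (e * (f * X))) + X * (p * c * (e * T * f)) ≡ p * c * (e * (f * X * (T + W * J)))
    regroup = solve-∀ ℚ-ring

  deriv-one : ∀ n → n ≥ 1 → deriv q 1 n ≡ iverson1 n
  deriv-one (suc n) _ = trans (deriv-suc 0 n) (trans (simplify (deriv q 0 n)) (value n))
    where
    simplify : ∀ x → 1ℚ * x + 0ℚ * x ≡ x
    simplify = solve-∀ ℚ-ring
    value : ∀ n → deriv q 0 n ≡ iverson1 (suc n)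
    value zero    = refl
    value (suc n) = deriv-zero-suc n

  -- q-Genocchi numbers

  qfact÷ : ∀ {m l} → l ℕ.≤ m →
    qfact q (2 ℕ.* m) * inv (qfact q (2 ℕ.* m ∸ 2 ℕ.* l)) ≡ falling q (2 ℕ.* m) (2 ℕ.* l)
  qfact÷ {m} {l} l≤m = begin
    qfact q (2 ℕ.* m) * inv f                       ≡⟨ cong (λ i → qfact q i * inv f) (ℕ.m+[n∸m]≡n 2l≤2m) ⟨
    qfact q (2 ℕ.* l ℕ.+ r) * inv f                 ≡⟨ cong (_* inv f) (falling-qfact q (2 ℕ.* l) r) ⟨
    falling q (2 ℕ.* l ℕ.+ r) (2 ℕ.* l) * f * inv f ≡⟨ cong (λ i → falling q i (2 ℕ.* l) * f * inv f) (ℕ.m+[n∸m]≡n 2l≤2m) ⟩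
    g * f * inv f                                   ≡⟨ *-assoc g f (inv f) ⟩
    g * (f * inv f)                                 ≡⟨ cong (g *_) (inv-inverseʳ (qfact≢0 r)) ⟩
    g * 1ℚ                                          ≡⟨ *-identityʳ g ⟩
    g                                               ∎
    where
    2l≤2m = ℕ.*-monoʳ-≤ 2 l≤m
    r = 2 ℕ.* m ∸ 2 ℕ.* l
    f = qfact q r
    g = falling q (2 ℕ.* m) (2 ℕ.* l)

  denom-even : ∀ r → denom q (2 ℕ.* r) ≡ inv (qfact q (2 ℕ.* r)) + inv (qfact q (2 ℕ.* r))
  denom-even r = cong (e +_) (trans (cong (_* e) (-1^even r)) (*-identityˡ e))
    where e = inv (qfact q (2 ℕ.* r))

  -1^odd-* : ∀ r (e : ℚ) → (- 1ℚ) ^ suc (2 ℕ.* r) * e ≡ - e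
  -1^odd-* r e = trans (cong (λ x → - 1ℚ * x * e) (-1^even r)) (negate e)
    where
    negate : ∀ e → - 1ℚ * 1ℚ * e ≡ - e
    negate = solve-∀ ℚ-ring

  denom-odd : ∀ r → denom q (suc (2 ℕ.* r)) ≡ 0ℚ
  denom-odd r = trans (cong (e +_) (-1^odd-* r e)) (+-inverseʳ e)
    where e = inv (qfact q (suc (2 ℕ.* r)))

  numer-even : ∀ m → qfact q (2 ℕ.* m) * numer q (2 ℕ.* m) ≡ falling q (2 ℕ.* m) 1 + falling q (2 ℕ.* m) 1
  numer-even zero    = refl
  numer-even (suc m) = subst (λ i → qfact q i * numer q i ≡ falling q i 1 + falling q i 1) (sym (ℕ.*-suc 2 m)) (begin
    f * x * (e - (- 1ℚ) ^ suc (2 ℕ.* m) * e)  ≡⟨ cong (λ y → f * x * (e - y)) (-1^odd-* m e) ⟩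
    f * x * (e - - e)                         ≡⟨ rearrange f x e ⟩
    (f * e) * (x * 1ℚ + x * 1ℚ)               ≡⟨ cong (_* (x * 1ℚ + x * 1ℚ)) (inv-inverseʳ (qfact≢0 (suc (2 ℕ.* m)))) ⟩
    1ℚ * (x * 1ℚ + x * 1ℚ)                    ≡⟨ *-identityˡ (x * 1ℚ + x * 1ℚ) ⟩
    x * 1ℚ + x * 1ℚ                           ∎)
    where
    f = qfact q (suc (2 ℕ.* m))
    x = qint q (suc (suc (2 ℕ.* m)))
    e = inv f
    rearrange : ∀ f x e → f * x * (e - - e) ≡ (f * e) * (x * 1ℚ + x * 1ℚ)
    rearrange = solve-∀ ℚ-ring

  -- The case P = x^(2m) of the identity for even polynomials: compare coefficients of z^(2m) in
  -- F(z) (e(z) + e(-z)) = z (e(z) - e(-z)) and multiply by [2m]!. Both sides then carry a factor 2,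
  -- which `double-injective` removes.
  genSeries-even : ∀ m →
    sumTo (suc m) (λ l → falling q (2 ℕ.* m) (2 ℕ.* l) * genSeries q (2 ℕ.* l)) ≡ falling q (2 ℕ.* m) 1
  genSeries-even m = double-injective (begin
    sumTo (suc m) t + sumTo (suc m) t
      ≡⟨ sumTo-+ (suc m) t t ⟨
    sumTo (suc m) (λ l → t l + t l)
      ≡⟨ sumTo-cong (suc m) (λ l l<1+m → term l (ℕ.≤-pred l<1+m)) ⟨
    sumTo (suc m) (λ l → f * u (2 ℕ.* l))
      ≡⟨ sumTo-*ˡ (suc m) f (λ l → u (2 ℕ.* l)) ⟩
    f * sumTo (suc m) (λ l → u (2 ℕ.* l))
      ≡⟨ cong (f *_) (sumTo-even m u odd) ⟨
    f * sumTo (suc (2 ℕ.* m)) u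
      -- The constant term of `denom q` evaluates to 2, so the absurd pattern suffices.
      ≡⟨ cong (f *_) (seriesDiv-* (numer q) (denom q) (λ ()) (2 ℕ.* m)) ⟩
    f * numer q (2 ℕ.* m)
      ≡⟨ numer-even m ⟩
    falling q (2 ℕ.* m) 1 + falling q (2 ℕ.* m) 1 ∎)
    where
    f = qfact q (2 ℕ.* m)
    t u : ℕ → ℚ
    t l = falling q (2 ℕ.* m) (2 ℕ.* l) * genSeries q (2 ℕ.* l)
    u i = genSeries q i * denom q (2 ℕ.* m ∸ i)

    rearrange : ∀ f g e → f * (g * (e + e)) ≡ f * e * g + f * e * g
    rearrange = solve-∀ ℚ-ring

    term : ∀ l → l ℕ.≤ m → f * u (2 ℕ.* l) ≡ t l + t l
    term l l≤m = begin
      f * (g * denom q r)            ≡⟨ cong (λ y → f * (g * y)) even ⟩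
      f * (g * (e + e))              ≡⟨ rearrange f g e ⟩
      f * e * g + f * e * g          ≡⟨ cong (λ y → y * g + y * g) (qfact÷ l≤m) ⟩
      t l + t l                      ∎
      where
      r = 2 ℕ.* m ∸ 2 ℕ.* l
      g = genSeries q (2 ℕ.* l)
      e = inv (qfact q r)
      even : denom q r ≡ e + e
      even = subst (λ i → denom q i ≡ inv (qfact q i) + inv (qfact q i)) (ℕ.*-distribˡ-∸ 2 m l) (denom-even (m ∸ l))

    odd : ∀ l → l ℕ.< m → u (suc (2 ℕ.* l)) ≡ 0ℚ
    odd l l<m = trans
      (cong (genSeries q (suc (2 ℕ.* l)) *_) (trans (cong (denom q) index) (denom-odd (m ∸ suc l))))
      (*-zeroʳ (genSeries q (suc (2 ℕ.* l))))
      where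
      index : 2 ℕ.* m ∸ suc (2 ℕ.* l) ≡ suc (2 ℕ.* (m ∸ suc l))
      index = begin
        2 ℕ.* m ∸ suc (2 ℕ.* l)
          ≡⟨ cong (λ i → 2 ℕ.* i ∸ suc (2 ℕ.* l)) (ℕ.m+[n∸m]≡n l<m) ⟨
        2 ℕ.* (suc l ℕ.+ (m ∸ suc l)) ∸ suc (2 ℕ.* l)
          ≡⟨ cong (_∸ suc (2 ℕ.* l)) (trans (ℕ.*-distribˡ-+ 2 (suc l) (m ∸ suc l)) (cong (ℕ._+ 2 ℕ.* (m ∸ suc l)) (ℕ.*-suc 2 l))) ⟩
        suc (2 ℕ.* l ℕ.+ 2 ℕ.* (m ∸ suc l)) ∸ 2 ℕ.* l
          ≡⟨ cong (_∸ 2 ℕ.* l) (ℕ.+-suc (2 ℕ.* l) (2 ℕ.* (m ∸ suc l))) ⟨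
        2 ℕ.* l ℕ.+ suc (2 ℕ.* (m ∸ suc l)) ∸ 2 ℕ.* l
          ≡⟨ ℕ.m+n∸m≡n (2 ℕ.* l) (suc (2 ℕ.* (m ∸ suc l))) ⟩
        suc (2 ℕ.* (m ∸ suc l)) ∎

  -- Linearity extends `genSeries-even` from monomials to R_n, after exchanging the sum over
  -- derivatives with the sum over coefficients.
  genSeries-deriv : ∀ n →
    sumTo (suc n) (λ l → deriv q (2 ℕ.* l) n * genSeries q (2 ℕ.* l)) ≡ deriv q 1 n
  genSeries-deriv n = begin
    sumTo (suc n) (λ l → deriv q (2 ℕ.* l) n * g l)
      ≡⟨ sumTo-cong (suc n) (λ l _ → trans (*-comm (deriv q (2 ℕ.* l) n) (g l))
           (sym (sumTo-*ˡ (suc n) (g l) (λ k → w k * falling q (2 ℕ.* (n ∸ k)) (2 ℕ.* l))))) ⟩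
    sumTo (suc n) (λ l → sumTo (suc n) (λ k → g l * (w k * falling q (2 ℕ.* (n ∸ k)) (2 ℕ.* l))))
      ≡⟨ sumTo-swap (suc n) (suc n) (λ l k → g l * (w k * falling q (2 ℕ.* (n ∸ k)) (2 ℕ.* l))) ⟩
    sumTo (suc n) (λ k → sumTo (suc n) (λ l → g l * (w k * falling q (2 ℕ.* (n ∸ k)) (2 ℕ.* l))))
      ≡⟨ sumTo-cong (suc n) (λ k _ → inner k) ⟩
    deriv q 1 n ∎
    where
    g w : ℕ → ℚ
    g l = genSeries q (2 ℕ.* l)
    w = weight q n
    rearrange : ∀ g w f → g * (w * f) ≡ w * (f * g)
    rearrange = solve-∀ ℚ-ring
    inner : ∀ k → sumTo (suc n) (λ l → g l * (w k * falling q (2 ℕ.* (n ∸ k)) (2 ℕ.* l))) ≡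
      w k * falling q (2 ℕ.* (n ∸ k)) 1
    inner k = begin
      sumTo (suc n) (λ l → g l * (w k * falling q (2 ℕ.* m) (2 ℕ.* l)))
        ≡⟨ sumTo-cong (suc n) (λ l _ → rearrange (g l) (w k) (falling q (2 ℕ.* m) (2 ℕ.* l))) ⟩
      sumTo (suc n) (λ l → w k * (falling q (2 ℕ.* m) (2 ℕ.* l) * g l))
        ≡⟨ sumTo-*ˡ (suc n) (w k) (λ l → falling q (2 ℕ.* m) (2 ℕ.* l) * g l) ⟩
      w k * sumTo (suc n) (λ l → falling q (2 ℕ.* m) (2 ℕ.* l) * g l)
        -- Derivatives of order 2l > 2m annihilate x^(2m), so the common range l ≤ n may be cut to l
        -- ≤ m.
        ≡⟨ cong (w k *_) (sumTo-truncate (s≤s (ℕ.m∸n≤m n k)) (λ l m<l →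
             trans (cong (_* g l) (falling-zero q (ℕ.*-monoʳ-< 2 m<l))) (*-zeroˡ (g l)))) ⟩
      w k * sumTo (suc m) (λ l → falling q (2 ℕ.* m) (2 ℕ.* l) * g l)
        ≡⟨ cong (w k *_) (genSeries-even m) ⟩
      w k * falling q (2 ℕ.* m) 1 ∎
      where m = n ∸ k

  -- The summands of the q-Seidel formula

  -- It is a factor of the nonzero [2n+2].
  1+q^≢0 : ∀ n → 1ℚ + q ^ suc n ≢ 0ℚ
  1+q^≢0 n eq = qint-even≢0 n (begin
    qint q (2 ℕ.* suc n)               ≡⟨ qint-double q (suc n) ⟩
    qint q (suc n) * (1ℚ + q ^ suc n)  ≡⟨ cong (qint q (suc n) *_) eq ⟩
    qint q (suc n) * 0ℚ                ≡⟨ *-zeroʳ (qint q (suc n)) ⟩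
    0ℚ                                 ∎)

  -- This is (-q^b;q)_m with the signs resolved and the exponents merged, so that consecutive blocks
  -- join by `prodTo-+`.
  pochPlus : ℕ → ℕ → ℚ
  pochPlus b m = prodTo m (λ i → 1ℚ + q ^ (b ℕ.+ i))

  poch≡pochPlus : ∀ b m → poch (- (q ^ b)) q m ≡ pochPlus b m
  poch≡pochPlus b m = prodTo-cong m (λ i →
    trans (double-negation (q ^ b) (q ^ i)) (cong (1ℚ +_) (sym (^-+ q b i))))
    where
    double-negation : ∀ x y → 1ℚ - (- x) * y ≡ 1ℚ + x * y
    double-negation = solve-∀ ℚ-ring

  poch-neg≡pochPlus : ∀ m → poch (- q) q m ≡ pochPlus 1 m
  poch-neg≡pochPlus m = trans (cong (λ x → poch (- x) q m) (sym (*-identityʳ q))) (poch≡pochPlus 1 m)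

  pochPlus-+ : ∀ m n → pochPlus 1 (m ℕ.+ n) ≡ pochPlus 1 m * pochPlus (suc m) n
  pochPlus-+ m n = prodTo-+ m n (λ i → 1ℚ + q ^ suc i)

  pochPlus≢0 : ∀ b m → pochPlus (suc b) m ≢ 0ℚ
  pochPlus≢0 b m = prodTo-≢0 m (λ i → 1+q^≢0 (b ℕ.+ i))

  -- From [2i] = [i](1 + q^i). It links the [n-2k]! of the q-binomial to the denominator in
  -- `deriv-closed`.
  evenFact-split : ∀ s → evenFact q s ≡ qfact q s * pochPlus 1 s
  evenFact-split zero    = refl
  evenFact-split (suc s) =
    trans (cong₂ _*_ (evenFact-split s) (qint-double q (suc s)))
      (interchange (qfact q s) (pochPlus 1 s) (qint q (suc s)) (1ℚ + q ^ suc s))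
    where
    interchange : ∀ a b c d → (a * b) * (c * d) ≡ (a * c) * (b * d)
    interchange = solve-∀ ℚ-ring

  seidelTerm : ℕ → ℕ → ℚ
  seidelTerm n k =
    q ^ ((2 ℕ.* k) C 2) * qbinom q n (2 ℕ.* k) * (- 1ℚ) ^ k
      * (poch (- (q ^ (n ∸ 2 ℕ.* k ℕ.+ 1))) q (2 ℕ.* k)
         ÷ poch (- (q ^ (2 ℕ.* n ∸ 2 ℕ.* k))) q (2 ℕ.* k))
      * qGenocchi q (n ∸ k)

  seidelScale : ℕ → ℚ
  seidelScale n = (- 1ℚ) ^ (n ∸ 1) * qfact q n * pochPlus 1 n * inv (pochPlus 1 (2 ℕ.* n ∸ 1))

  -- The signs multiply to (-1)^(n-1), and the denominators (-q;q)_{2n-2k-1} and (-q^(2n-2k);q)_{2k}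
  -- join to (-q;q)_{2n-1}. What still depends on `k` is the closed form from `deriv-closed` with
  -- `j` = 2k, times a coefficient of F.
  seidelTerm-deriv : ∀ {n} k → n ≥ 1 → 2 ℕ.* k ℕ.≤ n →
    seidelTerm n k ≡ seidelScale n * (deriv q (2 ℕ.* (n ∸ k)) n * genSeries q (2 ℕ.* (n ∸ k)))
  seidelTerm-deriv {n} k n≥1 2k≤n = begin
    seidelTerm n k
      ≡⟨ cong (λ y → Q * (fn * inv (fj * fs)) * ε^ k * y * qGenocchi q (n ∸ k))
           (cong₂ (λ y z → y * inv z) P₁-eq P₂-eq) ⟩
    Q * (fn * inv (fj * fs)) * ε^ k * (P₁ * inv P₂) * (ε^ (n ∸ k ∸ 1) * F * fM * inv (poch (- q) q M′))
      ≡⟨ cong₂ (λ y z → Q * (fn * y) * ε^ k * (P₁ * inv P₂) * (ε^ (n ∸ k ∸ 1) * F * fM * inv z))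
           (inv-* (qfact≢0 (2 ℕ.* k)) (qfact≢0 s)) (poch-neg≡pochPlus M′) ⟩
    Q * (fn * (inv fj * inv fs)) * ε^ k * (P₁ * inv P₂) * (ε^ (n ∸ k ∸ 1) * F * fM * inv P₃)
      ≡⟨ insert Q fn (inv fj) (inv fs) (ε^ k) P₁ (inv P₂) (ε^ (n ∸ k ∸ 1)) F fM (inv P₃) ⟩
    (ε^ k * ε^ (n ∸ k ∸ 1)) * fn * (1ℚ * P₁) * (inv P₃ * inv P₂) * (inv fj * (Q * (inv fs * fM)) * F)
      -- Inserting (-q;q)_{n-2k} and its inverse: the former completes `P₁` to (-q;q)_n, the latter
      -- completes 1/[n-2k]! to the inverse of `evenFact q s`.
      ≡⟨ cong (λ y → (ε^ k * ε^ (n ∸ k ∸ 1)) * fn * (y * P₁) * (inv P₃ * inv P₂) * (inv fj * (Q * (inv fs * fM)) * F))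
           (inv-inverseʳ (pochPlus≢0 0 s)) ⟨
    (ε^ k * ε^ (n ∸ k ∸ 1)) * fn * (Ps * inv Ps * P₁) * (inv P₃ * inv P₂) * (inv fj * (Q * (inv fs * fM)) * F)
      ≡⟨ regroup (ε^ k * ε^ (n ∸ k ∸ 1)) fn Ps (inv Ps) P₁ (inv P₃ * inv P₂) (inv fj) Q (inv fs) fM F ⟩
    (ε^ k * ε^ (n ∸ k ∸ 1)) * fn * (Ps * P₁) * (inv P₃ * inv P₂) * (inv fj * (Q * (inv fs * inv Ps * fM)) * F)
      ≡⟨ cong₂ (λ y z → (ε^ k * ε^ (n ∸ k ∸ 1)) * fn * (Ps * P₁) * y * (z * F)) P-inv closed ⟩
    (ε^ k * ε^ (n ∸ k ∸ 1)) * fn * (Ps * P₁) * inv (pochPlus 1 (2 ℕ.* n ∸ 1)) * (deriv q M n * F)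
      ≡⟨ cong₂ (λ y z → y * fn * z * inv (pochPlus 1 (2 ℕ.* n ∸ 1)) * (deriv q M n * F)) sign P-split ⟩
    seidelScale n * (deriv q M n * F) ∎
    where
    ε^ : ℕ → ℚ
    ε^ i = (- 1ℚ) ^ i
    s = n ∸ 2 ℕ.* k
    M = 2 ℕ.* (n ∸ k)
    M′ = M ∸ 1
    Q = q ^ ((2 ℕ.* k) C 2)
    fn = qfact q n
    fj = qfact q (2 ℕ.* k)
    fs = qfact q s
    fM = qfact q M
    F = genSeries q M
    P₁ = pochPlus (suc s) (2 ℕ.* k)
    P₂ = pochPlus (suc M′) (2 ℕ.* k)
    P₃ = pochPlus 1 M′
    Ps = pochPlus 1 s

    s+2k≡n : s ℕ.+ 2 ℕ.* k ≡ n
    s+2k≡n = ℕ.m∸n+n≡m 2k≤n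

    -- Strictness, which needs n ≥ 1 when k = 0, ensures that `n ∸ k ∸ 1` and `M ∸ 1` are true
    -- subtractions.
    k<n : k ℕ.< n
    k<n = positive-half k 2k≤n
      where
      positive-half : ∀ k → 2 ℕ.* k ℕ.≤ n → k ℕ.< n
      positive-half zero    _  = n≥1
      positive-half (suc k) le = ℕ.<-≤-trans (ℕ.m<m+n (suc k) (s≤s z≤n)) le

    1≤n∸k : 1 ℕ.≤ n ∸ k
    1≤n∸k = ℕ.m<n⇒0<n∸m k<n

    1+M′≡M : suc M′ ≡ M
    1+M′≡M = ℕ.m+[n∸m]≡n (ℕ.≤-trans 1≤n∸k (ℕ.m≤m+n (n ∸ k) (n ∸ k ℕ.+ 0)))

    M+2k≡2n : M ℕ.+ 2 ℕ.* k ≡ 2 ℕ.* n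
    M+2k≡2n = trans (sym (ℕ.*-distribˡ-+ 2 (n ∸ k) k)) (cong (2 ℕ.*_) (ℕ.m∸n+n≡m (ℕ.<⇒≤ k<n)))

    s+n≡M : s ℕ.+ n ≡ M
    s+n≡M = ℕ.+-cancelʳ-≡ (2 ℕ.* k) (s ℕ.+ n) M (begin
      s ℕ.+ n ℕ.+ 2 ℕ.* k    ≡⟨ ℕ.+-assoc s n (2 ℕ.* k) ⟩
      s ℕ.+ (n ℕ.+ 2 ℕ.* k)  ≡⟨ cong (s ℕ.+_) (ℕ.+-comm n (2 ℕ.* k)) ⟩
      s ℕ.+ (2 ℕ.* k ℕ.+ n)  ≡⟨ ℕ.+-assoc s (2 ℕ.* k) n ⟨
      s ℕ.+ 2 ℕ.* k ℕ.+ n    ≡⟨ cong₂ ℕ._+_ s+2k≡n (sym (ℕ.+-identityʳ n)) ⟩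
      2 ℕ.* n                ≡⟨ M+2k≡2n ⟨
      M ℕ.+ 2 ℕ.* k          ∎)

    P₁-eq : poch (- (q ^ (s ℕ.+ 1))) q (2 ℕ.* k) ≡ P₁
    P₁-eq = trans (cong (λ i → poch (- (q ^ i)) q (2 ℕ.* k)) (ℕ.+-comm s 1)) (poch≡pochPlus (suc s) (2 ℕ.* k))

    P₂-eq : poch (- (q ^ (2 ℕ.* n ∸ 2 ℕ.* k))) q (2 ℕ.* k) ≡ P₂
    P₂-eq = trans
      (cong (λ i → poch (- (q ^ i)) q (2 ℕ.* k)) (trans (sym (ℕ.*-distribˡ-∸ 2 n k)) (sym 1+M′≡M)))
      (poch≡pochPlus (suc M′) (2 ℕ.* k))

    P-inv : inv P₃ * inv P₂ ≡ inv (pochPlus 1 (2 ℕ.* n ∸ 1))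
    P-inv = begin
      inv P₃ * inv P₂                     ≡⟨ inv-* (pochPlus≢0 0 M′) (pochPlus≢0 M′ (2 ℕ.* k)) ⟨
      inv (P₃ * P₂)                       ≡⟨ cong inv (pochPlus-+ M′ (2 ℕ.* k)) ⟨
      inv (pochPlus 1 (M′ ℕ.+ 2 ℕ.* k))   ≡⟨ cong (λ i → inv (pochPlus 1 (i ∸ 1))) (trans (cong (ℕ._+ 2 ℕ.* k) 1+M′≡M) M+2k≡2n) ⟩
      inv (pochPlus 1 (2 ℕ.* n ∸ 1))      ∎

    P-split : Ps * P₁ ≡ pochPlus 1 n
    P-split = trans (sym (pochPlus-+ s (2 ℕ.* k))) (cong (pochPlus 1) s+2k≡n)

    sign : ε^ k * ε^ (n ∸ k ∸ 1) ≡ ε^ (n ∸ 1)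
    sign = trans (sym (^-+ (- 1ℚ) k (n ∸ k ∸ 1))) (cong ε^ (begin
      k ℕ.+ (n ∸ k ∸ 1)  ≡⟨ ℕ.+-∸-assoc k 1≤n∸k ⟨
      k ℕ.+ (n ∸ k) ∸ 1  ≡⟨ cong (_∸ 1) (ℕ.m+[n∸m]≡n (ℕ.<⇒≤ k<n)) ⟩
      n ∸ 1              ∎))

    cancel : ∀ x f d → f * d ≡ x → f ≢ 0ℚ → inv f * x ≡ d
    cancel x f d refl f≢0 = begin
      inv f * (f * d)  ≡⟨ reassociate (inv f) f d ⟩
      f * inv f * d    ≡⟨ cong (_* d) (inv-inverseʳ f≢0) ⟩
      1ℚ * d           ≡⟨ *-identityˡ d ⟩
      d                ∎
      where
      reassociate : ∀ a b c → a * (b * c) ≡ b * a * c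
      reassociate = solve-∀ ℚ-ring

    closed : inv fj * (Q * (inv fs * inv Ps * fM)) ≡ deriv q M n
    closed = begin
      inv fj * (Q * (inv fs * inv Ps * fM))
        ≡⟨ cong (λ y → inv fj * (Q * (y * fM))) (trans (sym (inv-* (qfact≢0 s) (pochPlus≢0 0 s))) (cong inv (sym (evenFact-split s)))) ⟩
      inv fj * (Q * (inv (evenFact q s) * fM))
        ≡⟨ cancel (Q * (inv (evenFact q s) * fM)) fj (deriv q M n)
             (subst (λ i → fj * deriv q i n ≡ Q * (inv (evenFact q s) * qfact q i)) s+n≡M
               (deriv-closed s (2 ℕ.* k) n (sym s+2k≡n)))
             (qfact≢0 (2 ℕ.* k)) ⟩
      deriv q M n ∎

    insert : ∀ Q fn ij is ε₁ P₁ i₂ ε₂ F fM i₃ →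
      Q * (fn * (ij * is)) * ε₁ * (P₁ * i₂) * (ε₂ * F * fM * i₃) ≡
      (ε₁ * ε₂) * fn * (1ℚ * P₁) * (i₃ * i₂) * (ij * (Q * (is * fM)) * F)
    insert = solve-∀ ℚ-ring

    regroup : ∀ ε fn P iP P₁ i ij Q is fM F →
      ε * fn * (P * iP * P₁) * i * (ij * (Q * (is * fM)) * F) ≡
      ε * fn * (P * P₁) * i * (ij * (Q * (is * iP * fM)) * F)
    regroup = solve-∀ ℚ-ring

  -- Summation over all k

  n<2k : ∀ {n k} → suc (n ℕ./ 2) ℕ.≤ k → n ℕ.< 2 ℕ.* k
  n<2k {n} {k} n/2<k = subst (ℕ._< 2 ℕ.* k) (sym (m≡m%n+[m/n]*n n 2))
    (ℕ.<-≤-trans (ℕ.+-monoˡ-< (n ℕ./ 2 ℕ.* 2) (m%n<n n 2))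
      (ℕ.≤-trans (ℕ.*-monoˡ-≤ 2 n/2<k) (ℕ.≤-reflexive (ℕ.*-comm k 2))))

  -- Once the summands are written with `deriv`, the range k ≤ n/2 extends to k ≤ n at no cost: for
  -- 2k > n the order 2(n-k) is less than n and `deriv-below` applies. The substitution l = n - k
  -- then gives the full sum of `genSeries-deriv`.
  seidel-scaled : ∀ n → n ≥ 1 → seidelLHS q n ≡ seidelScale n * deriv q 1 n
  seidel-scaled n n≥1 = begin
    seidelLHS q n
      ≡⟨ sumTo-cong (suc (n ℕ./ 2)) (λ k k<1+n/2 → seidelTerm-deriv k n≥1 (2k≤n k (ℕ.≤-pred k<1+n/2))) ⟩
    sumTo (suc (n ℕ./ 2)) (λ k → t (n ∸ k))
      ≡⟨ sumTo-truncate (s≤s (m/n≤m n 2)) (λ k n/2<k → vanish k (n<2k n/2<k)) ⟨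
    sumTo (suc n) (λ k → t (n ∸ k))
      ≡⟨ sumTo-reverse n t ⟩
    sumTo (suc n) t
      ≡⟨ sumTo-*ˡ (suc n) (seidelScale n) (λ l → deriv q (2 ℕ.* l) n * genSeries q (2 ℕ.* l)) ⟩
    seidelScale n * sumTo (suc n) (λ l → deriv q (2 ℕ.* l) n * genSeries q (2 ℕ.* l))
      ≡⟨ cong (seidelScale n *_) (genSeries-deriv n) ⟩
    seidelScale n * deriv q 1 n ∎
    where
    t : ℕ → ℚ
    t l = seidelScale n * (deriv q (2 ℕ.* l) n * genSeries q (2 ℕ.* l))

    2k≤n : ∀ k → k ℕ.≤ n ℕ./ 2 → 2 ℕ.* k ℕ.≤ n
    2k≤n k k≤n/2 = ℕ.≤-trans (ℕ.*-monoʳ-≤ 2 k≤n/2)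
      (ℕ.≤-trans (ℕ.≤-reflexive (ℕ.*-comm 2 (n ℕ./ 2))) (m/n*n≤m n 2))

    2[n∸k]<n : ∀ k → n ℕ.< 2 ℕ.* k → 2 ℕ.* (n ∸ k) ℕ.< n
    2[n∸k]<n k n<2k = subst (ℕ._< n) (sym (ℕ.*-distribˡ-∸ 2 n k))
      (ℕ.m<n+o⇒m∸n<o (2 ℕ.* n) (2 ℕ.* k) {{ℕ.>-nonZero n≥1}}
        (subst (ℕ._< 2 ℕ.* k ℕ.+ n) (cong (n ℕ.+_) (sym (ℕ.+-identityʳ n))) (ℕ.+-monoˡ-< n n<2k)))

    vanish : ∀ k → n ℕ.< 2 ℕ.* k → t (n ∸ k) ≡ 0ℚ
    vanish k n<2k = begin
      seidelScale n * (deriv q (2 ℕ.* (n ∸ k)) n * g)  ≡⟨ cong (λ y → seidelScale n * (y * g)) (deriv-below (2[n∸k]<n k n<2k)) ⟩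
      seidelScale n * (0ℚ * g)                         ≡⟨ cong (seidelScale n *_) (*-zeroˡ g) ⟩
      seidelScale n * 0ℚ                               ≡⟨ *-zeroʳ (seidelScale n) ⟩
      0ℚ                                               ∎
      where g = genSeries q (2 ℕ.* (n ∸ k))

  -- Only n = 1 has content: there the scale is (1+q)/(1+q), with 1 + q nonzero.
  seidelScale-iverson : ∀ n → n ≥ 1 → seidelScale n * iverson1 n ≡ iverson1 n
  seidelScale-iverson (suc zero)    _ = trans (simplify p (inv p)) (inv-inverseʳ (pochPlus≢0 0 1))
    where
    p = pochPlus 1 1
    simplify : ∀ p p′ → 1ℚ * 1ℚ * p * p′ * 1ℚ ≡ p * p′
    simplify = solve-∀ ℚ-ring
  seidelScale-iverson (suc (suc n)) _ = *-zeroʳ (seidelScale (suc (suc n)))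

theorem3p5 : (q : ℚ) → q ≢ - 1ℚ → (n : ℕ) → n ≥ 1 → seidelLHS q n ≡ iverson1 n
theorem3p5 q q≢-1 n n≥1 = begin
  seidelLHS q n                            ≡⟨ seidel-scaled q≢-1 n n≥1 ⟩
  seidelScale q≢-1 n * deriv q 1 n         ≡⟨ cong (seidelScale q≢-1 n *_) (deriv-one q≢-1 n n≥1) ⟩
  seidelScale q≢-1 n * iverson1 n          ≡⟨ seidelScale-iverson q≢-1 n n≥1 ⟩
  iverson1 n                               ∎
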